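{- Fix positive integers $m_1,m_2,m_3$. Let $A_1$ be an $m_1\times m_1$ coloring matrix, $A_2$ an $m_1\times m_2$ matrix with entries in $\{0,1\}$, and $B=(b_{ij})$ an $m_3\times m_2$ matrix with entries in $\{0,1\}$. Let $$A=\left[\begin{array}{c|c}A_1&A_2\\\hline0&0\end{array}\right],\qquad A'=\left[\begin{array}{c|c|c}A_1&A_2&0\\\hline0&0&0\\\hline0&B&0\end{array}\right],$$ where the $0$'s are zero blocks of the sizes making $A$ an $(m_1+m_2)\times(m_1+m_2)$ matrix and $A'$ an $(m_1+m_2+m_3)\times(m_1+m_2+m_3)$ matrix. Then $$F_{A'}(x)=F_A(x)+x\sum_{i=1}^{m_3}\frac{1}{1-x\sum_{j=1}^{m_2}b_{ij}}.$$ In particular, for $1\le i\le m_1+m_2$ we have $t^{(i)}_{A'}(n)=t^{(i)}_A(n)$ for all $n\ge1$, and for $m_1+m_2<i\le m_1+m_2+m_3$ we have $$t^{(i)}_{A'}(n)=\Big(\sum_{j=1}^{m_2}b_{i-m_1-m_2,j}\Big)^{n-1}$$ for all $n\ge1$.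
   Context: A plane tree is an unlabeled rooted tree in which the children of every vertex are linearly ordered. A coloring matrix is a square matrix $A=(a_{ij})$ with entries in $\{0,1\}$. An $A$-coloring of a plane tree assigns to each vertex a color (an index of a row of $A$) such that whenever a vertex of color $j$ is a child of a vertex of color $i$, $a_{ij}=1$. Let $t_A(n)$ be the number of pairs (plane tree with $n$ vertices, $A$-coloring of it), $t_A^{(i)}(n)$ the number of those with root color $i$, and $F_A(x)=\sum_{n\ge1}t_A(n)x^n$. -}

module Defs where

open import Algebra.Definitions.RawMonoid using (sum)
open import Data.Fin.Base using (Fin; zero; suc; toℕ)
open import Data.Fin.Properties using (1↔⊤; +↔⊎; *↔×) renaming (_≟_ to _≟ᶠ_)
open import Data.Integer.Base as ℤ using (ℤ; +_; 0ℤ; 1ℤ)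
import Data.Integer.Properties as ℤₚ
open import Data.List.Base using (List; []; _∷_)
open import Data.List.Relation.Unary.All using (All; []; _∷_)
open import Data.Nat.Base as ℕ using (ℕ; zero; suc; _+_; _∸_; _≤_; z≤n; s≤s)
import Data.Nat.Properties as ℕₚ
open import Data.Product.Base using (∃; _×_; _,_)
open import Data.Product.Function.NonDependent.Propositional using (_×-↔_)
open import Data.Sum.Base using (_⊎_; inj₁; inj₂)
open import Data.Sum.Function.Propositional using (_⊎-↔_)
open import Data.Unit.Base using (⊤; tt)
open import Data.Vec.Functional as Vector using (Vector; _++_)
open import Function.Base using (_∘_)
open import Function.Bundles using (_↔_; mk↔ₛ′)
open import Function.Construct.Composition using (_↔-∘_)
open import Relation.Binary.PropositionalEquality using (_≡_; _≗_; refl; sym; trans; cong; cong₂; module ≡-Reasoning)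
open import Relation.Nullary using (yes; no; contradiction)
open import Axiom.UniquenessOfIdentityProofs using (module Decidable⇒UIP)

Bit : Set
Bit = Fin 2

0b 1b : Bit
0b = zero
1b = suc zero

Matrix : ℕ → ℕ → Set
Matrix m n = Vector (Vector Bit n) m

𝟎 : ∀ m n → Matrix m n
𝟎 _ _ _ _ = 0b

infixl 7 _∥_
infixl 6 _⫽_

_∥_ : ∀ {m n p} → Matrix m n → Matrix m p → Matrix m (n + p)
(M ∥ N) i = M i ++ N i

_⫽_ : ∀ {m n p} → Matrix m p → Matrix n p → Matrix (m + n) p
M ⫽ N = M ++ N

blockA : ∀ {m₁ m₂} → Matrix m₁ m₁ → Matrix m₁ m₂ → Matrix (m₁ + m₂) (m₁ + m₂)
blockA {m₁} {m₂} A₁ A₂ = A₁      ∥ A₂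
                       ⫽ 𝟎 m₂ m₁ ∥ 𝟎 m₂ m₂

blockA′ : ∀ {m₁ m₂ m₃} → Matrix m₁ m₁ → Matrix m₁ m₂ → Matrix m₃ m₂ → Matrix (m₁ + m₂ + m₃) (m₁ + m₂ + m₃)
blockA′ {m₁} {m₂} {m₃} A₁ A₂ B = A₁      ∥ A₂      ∥ 𝟎 m₁ m₃
                               ⫽ 𝟎 m₂ m₁ ∥ 𝟎 m₂ m₂ ∥ 𝟎 m₂ m₃
                               ⫽ 𝟎 m₃ m₁ ∥ B       ∥ 𝟎 m₃ m₃

rowSum : ∀ {m n} → Matrix m n → Fin m → ℕ
rowSum M i = sum ℕ.+-0-rawMonoid (λ j → toℕ (M i j))

data PlaneTree : Set where
  node : List PlaneTree → PlaneTree

size  : PlaneTree → ℕ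
sizes : List PlaneTree → ℕ
size (node ts)  = suc (sizes ts)
sizes []        = 0
sizes (t ∷ ts)  = size t + sizes ts

-- Coloring A i t: the A-colorings of t whose root has color i.  Every child
-- of the root receives a color j with aᵢⱼ = 1, and its subtree is colored
-- recursively.
data Coloring {m} (A : Matrix m m) (i : Fin m) : PlaneTree → Set where
  node : ∀ {ts} → All (λ t → ∃ λ j → A i j ≡ 1b × Coloring A j t) ts → Coloring A i (node ts)

RootedColoredTree : ∀ {m} → Matrix m m → Fin m → ℕ → Set
RootedColoredTree A i n = ∃ λ t → size t ≡ n × Coloring A i t

ColoredTree : ∀ {m} → Matrix m m → ℕ → Set
ColoredTree A n = ∃ λ t → size t ≡ n × (∃ λ i → Coloring A i t)

record Finite (X : Set) : Set where
  constructor mkFinite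
  field
    card        : ℕ
    enumeration : Fin card ↔ X

open Finite public

finite-↔ : ∀ {X Y} → Finite X → X ↔ Y → Finite Y
finite-↔ (mkFinite k e) f = mkFinite k (f ↔-∘ e)

finite-× : ∀ {X Y} → Finite X → Finite Y → Finite (X × Y)
finite-× (mkFinite k e) (mkFinite l f) = mkFinite (k ℕ.* l) ((e ×-↔ f) ↔-∘ *↔×)

finite-⊎ : ∀ {X Y} → Finite X → Finite Y → Finite (X ⊎ Y)
finite-⊎ (mkFinite k e) (mkFinite l f) = mkFinite (k + l) ((e ⊎-↔ f) ↔-∘ +↔⊎)

finite-ΣFin : ∀ {m} {P : Fin m → Set} → (∀ i → Finite (P i)) → Finite (∃ P)
finite-ΣFin {zero} fin = mkFinite 0 (mk↔ₛ′ (λ ()) (λ ()) (λ ()) (λ ()))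
finite-ΣFin {suc m} {P} fin =
  finite-↔ (finite-⊎ (fin zero) (finite-ΣFin (fin ∘ suc)))
    (mk↔ₛ′ to from (λ { (zero , _) → refl ; (suc _ , _) → refl })
                   (λ { (inj₁ _) → refl ; (inj₂ _) → refl }))
  where
  to : P zero ⊎ ∃ (P ∘ suc) → ∃ P
  to (inj₁ p)       = zero , p
  to (inj₂ (i , p)) = suc i , p
  from : ∃ P → P zero ⊎ ∃ (P ∘ suc)
  from (zero  , p) = inj₁ p
  from (suc i , p) = inj₂ (i , p)

finite-≡ : ∀ {m} (i j : Fin m) → Finite (i ≡ j)
finite-≡ i j with i ≟ᶠ j
... | yes p = mkFinite 1 (mk↔ₛ′ (λ _ → p) (λ _ → zero)
                    (λ q → Decidable⇒UIP.≡-irrelevant _≟ᶠ_ p q) (λ { zero → refl }))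
... | no ¬p = mkFinite 0 (mk↔ₛ′ (λ ()) (λ q → contradiction q ¬p) (λ q → contradiction q ¬p) (λ ()))

finite-conv : ∀ {P Q : ℕ → Set} n → (∀ k → k ≤ n → Finite (P k)) → (∀ k → k ≤ n → Finite (Q k)) →
              Finite (∃ λ a → ∃ λ b → a + b ≡ n × P a × Q b)
finite-conv {P} {Q} zero finP finQ =
  finite-↔ (finite-× (finP 0 z≤n) (finQ 0 z≤n))
    (mk↔ₛ′ to from (λ { (zero , _ , refl , p , q) → refl }) (λ _ → refl))
  where
  T : Set
  T = ∃ λ a → ∃ λ b → a + b ≡ 0 × P a × Q b
  to : P 0 × Q 0 → T
  to (p , q) = 0 , 0 , refl , p , q
  from : T → P 0 × Q 0
  from (zero , _ , refl , p , q) = p , q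
finite-conv {P} {Q} (suc n) finP finQ =
  finite-↔ (finite-⊎ (finite-× (finP 0 z≤n) (finQ (suc n) ℕₚ.≤-refl))
                     (finite-conv n (λ k k≤n → finP (suc k) (s≤s k≤n))
                                    (λ k k≤n → finQ k (ℕₚ.m≤n⇒m≤1+n k≤n))))
    (mk↔ₛ′ to from (λ { (zero , _ , refl , p , q) → refl ; (suc a , b , refl , p , q) → refl })
                   (λ { (inj₁ _) → refl ; (inj₂ (a , b , refl , p , q)) → refl }))
  where
  S T : Set
  S = (P 0 × Q (suc n)) ⊎ (∃ λ a → ∃ λ b → a + b ≡ n × P (suc a) × Q b)
  T = ∃ λ a → ∃ λ b → a + b ≡ suc n × P a × Q b
  to : S → T
  to (inj₁ (p , q))               = 0 , suc n , refl , p , q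
  to (inj₂ (a , b , refl , p , q)) = suc a , b , refl , p , q
  from : T → S
  from (zero  , _ , refl , p , q) = inj₁ (p , q)
  from (suc a , b , refl , p , q) = inj₂ (a , b , refl , p , q)

module _ {m} (A : Matrix m m) where

  Child : Fin m → PlaneTree → Set
  Child i t = ∃ λ j → A i j ≡ 1b × Coloring A j t

  Forest : Fin m → ℕ → Set
  Forest i n = ∃ λ ts → sizes ts ≡ n × All (Child i) ts

  forest-[] : ∀ i → ⊤ ↔ Forest i 0
  forest-[] i = mk↔ₛ′ (λ _ → [] , refl , []) (λ _ → tt)
                  (λ { ([] , refl , []) → refl ; (node _ ∷ _ , () , _) }) (λ _ → refl)

  -- A nonempty forest is a first tree, with a vertices below its root, and
  -- the remaining forest.
  forest-∷ : ∀ i n → (∃ λ a → ∃ λ b → a + b ≡ n × (∃ λ j → A i j ≡ 1b × Forest j a) × Forest i b) ↔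
                     Forest i (suc n)
  forest-∷ i n = mk↔ₛ′
    (λ { (_ , _ , refl , (j , e , us , refl , cs) , ts , refl , ds) →
           node us ∷ ts , refl , (j , e , node cs) ∷ ds })
    (λ { (node us ∷ ts , refl , (j , e , node cs) ∷ ds) →
           sizes us , sizes ts , refl , (j , e , us , refl , cs) , ts , refl , ds })
    (λ { (node us ∷ ts , refl , (j , e , node cs) ∷ ds) → refl })
    (λ { (_ , _ , refl , (j , e , us , refl , cs) , ts , refl , ds) → refl })

  -- The first argument bounds the number of vertices, for termination.
  finite-forest : ∀ N n → n ≤ N → ∀ i → Finite (Forest i n)
  finite-forest _ zero _ i = mkFinite 1 (forest-[] i ↔-∘ 1↔⊤)
  finite-forest (suc N) (suc n) (s≤s n≤N) i =
    finite-↔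
      (finite-conv n
        (λ a a≤n → finite-ΣFin λ j →
          finite-× (finite-≡ (A i j) 1b) (finite-forest N a (ℕₚ.≤-trans a≤n n≤N) j))
        (λ b b≤n → finite-forest N b (ℕₚ.≤-trans b≤n n≤N) i))
      (forest-∷ i n)

  finite-rooted : ∀ i n → Finite (RootedColoredTree A i n)
  finite-rooted i zero = mkFinite 0 (mk↔ₛ′ (λ ()) (λ { (node _ , () , _) }) (λ { (node _ , () , _) }) (λ ()))
  finite-rooted i (suc n) = finite-↔ (finite-forest n n ℕₚ.≤-refl i)
    (mk↔ₛ′ (λ { (ts , refl , cs) → node ts , refl , node cs })
           (λ { (node ts , refl , node cs) → ts , refl , cs })
           (λ { (node ts , refl , node cs) → refl })
           (λ { (ts , refl , cs) → refl }))

  finite-colored : ∀ n → Finite (ColoredTree A n)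
  finite-colored n = finite-↔ (finite-ΣFin λ i → finite-rooted i n)
    (mk↔ₛ′ (λ (i , t , e , c) → t , e , i , c) (λ (t , e , i , c) → i , t , e , c)
           (λ _ → refl) (λ _ → refl))

  tRoot : Fin m → ℕ → ℕ
  tRoot i n = card (finite-rooted i n)

  t : ℕ → ℕ
  t n = card (finite-colored n)

Series : Set
Series = ℕ → ℤ

infix  4 _≈ˢ_
infixl 6 _+ˢ_ _-ˢ_
infixl 7 _*ˢ_

_≈ˢ_ : Series → Series → Set
f ≈ˢ g = f ≗ g

0ˢ 1ˢ x : Series
0ˢ _ = 0ℤ
1ˢ zero    = 1ℤ
1ˢ (suc _) = 0ℤ
x 1 = 1ℤ
x _ = 0ℤ

const : ℤ → Series
const c zero    = c
const c (suc _) = 0ℤ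

_+ˢ_ _-ˢ_ _*ˢ_ : Series → Series → Series
(f +ˢ g) n = f n ℤ.+ g n
(f -ˢ g) n = f n ℤ.- g n
(f *ˢ g) n = sum ℤ.+-0-rawMonoid {suc n} (λ k → f (toℕ k) ℤ.* g (n ∸ toℕ k))

∑ˢ : ∀ {m} → Vector Series m → Series
∑ˢ = sum (record { Carrier = Series ; _≈_ = _≈ˢ_ ; _∙_ = _+ˢ_ ; ε = 0ˢ })

-- recipVec f n lists the coefficients gₙ₋₁, …, g₀ of g = 1/f, obtained from
-- f₀ = 1 and f g = 1 by gₙ = [n = 0] − (f₁ gₙ₋₁ + ⋯ + fₙ g₀).
recipCoeff : Series → ℕ → ℤ
recipVec   : Series → ∀ n → Vector ℤ n
recipCoeff f n = 1ˢ n ℤ.- sum ℤ.+-0-rawMonoid (λ k → f (suc (toℕ k)) ℤ.* recipVec f n k)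
recipVec f zero    = Vector.[]
recipVec f (suc n) = recipCoeff f n Vector.∷ recipVec f n

recip : (f : Series) → f 0 ≡ 1ℤ → Series
recip f _ = recipCoeff f

recipVec-correct : ∀ f n k → recipVec f n k ≡ recipCoeff f (n ∸ suc (toℕ k))
recipVec-correct f (suc n) zero    = refl
recipVec-correct f (suc n) (suc k) = recipVec-correct f n k

sum-cong : ∀ {n} {u v : Vector ℤ n} → u ≗ v → sum ℤ.+-0-rawMonoid u ≡ sum ℤ.+-0-rawMonoid v
sum-cong {zero}  _ = refl
sum-cong {suc n} e = cong₂ ℤ._+_ (e zero) (sum-cong (e ∘ suc))

*ˢ-recip : ∀ f (f₀≡1 : f 0 ≡ 1ℤ) → f *ˢ recip f f₀≡1 ≈ˢ 1ˢ
*ˢ-recip f f₀≡1 n = begin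
  f 0 ℤ.* g n ℤ.+ ∑ (λ k → f (suc (toℕ k)) ℤ.* g (n ∸ suc (toℕ k)))
    ≡⟨ cong₂ ℤ._+_ (trans (cong (ℤ._* g n) f₀≡1) (ℤₚ.*-identityˡ (g n)))
         (sum-cong {n} (λ k → cong (f (suc (toℕ k)) ℤ.*_) (sym (recipVec-correct f n k)))) ⟩
  (1ˢ n ℤ.- s) ℤ.+ s
    ≡⟨ ℤₚ.+-assoc (1ˢ n) (ℤ.- s) s ⟩
  1ˢ n ℤ.+ (ℤ.- s ℤ.+ s)
    ≡⟨ cong (λ z → 1ˢ n ℤ.+ z) (ℤₚ.+-inverseˡ s) ⟩
  1ˢ n ℤ.+ 0ℤ
    ≡⟨ ℤₚ.+-identityʳ (1ˢ n) ⟩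
  1ˢ n ∎
  where
  open ≡-Reasoning
  g = recip f f₀≡1
  ∑ : Vector ℤ n → ℤ
  ∑ = sum ℤ.+-0-rawMonoid
  s = ∑ (λ k → f (suc (toℕ k)) ℤ.* recipVec f n k)

F : ∀ {m} → Matrix m m → Series
F A zero    = 0ℤ
F A (suc n) = + t A (suc n)

{-# OPTIONS --safe #-}

-- The block shape of A′ says three things: colors of the first two blocks
-- never have children in the third, so trees rooted there are counted exactly
-- as for A; colors of the second block are sinks, i.e. label leaves only; and
-- every child of a color of the third block is a sink.  A tree whose root is
-- of the last kind is a star, with rowSum choices for each of its n − 1
-- leaves, which gives geometric series.

module Submission where

open import Defs
open import Data.Fin.Base using (Fin; zero; suc; toℕ; splitAt; _↑ˡ_; _↑ʳ_)
open import Data.Integer.Base as ℤ using (ℤ; +_; 0ℤ; 1ℤ)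
import Data.Integer.Properties as ℤₚ
open import Data.Nat.Base as ℕ using (ℕ; zero; suc; NonZero; _+_; _*_; _∸_; _^_; _≤_; z≤n; s≤s)
import Data.Nat.Properties as ℕₚ
open import Data.Product.Base using (∃; _×_; _,_)
open import Data.Sum.Base using (_⊎_; inj₁; inj₂)
open import Data.Vec.Functional using (Vector)
open import Data.Vec.Functional.Properties using (lookup-++ˡ; lookup-++ʳ)
open import Function.Base using (_∘_)
open import Relation.Binary.PropositionalEquality using (_≡_; refl; sym; trans; cong; cong₂; module ≡-Reasoning)

open import Algebra.Properties.Monoid.Sum ℕₚ.+-0-monoid using () renaming (sum to ∑; sum-cong-≗ to ∑-cong; sum-replicate-zero to ∑-replicate-zero)
open import Algebra.Properties.Monoid.Sum ℤₚ.+-0-monoid using () renaming (sum to ∑ᶻ; sum-replicate-zero to ∑ᶻ-replicate-zero)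

open ≡-Reasoning

-- Sums over index sets split into two blocks.

∑-zero : ∀ {n} {v : Vector ℕ n} → (∀ i → v i ≡ 0) → ∑ v ≡ 0
∑-zero {n} e = trans (∑-cong e) (∑-replicate-zero n)

∑-split : ∀ m {n} (v : Vector ℕ (m + n)) → ∑ v ≡ ∑ (v ∘ (_↑ˡ n)) + ∑ (v ∘ (m ↑ʳ_))
∑-split zero    v = refl
∑-split (suc m) v = trans (cong (v zero ℕ.+_) (∑-split m (v ∘ suc))) (sym (ℕₚ.+-assoc (v zero) _ _))

∑-↑ˡ : ∀ {m n} (v : Vector ℕ (m + n)) → (∀ k → v (m ↑ʳ k) ≡ 0) → ∑ v ≡ ∑ (v ∘ (_↑ˡ n))
∑-↑ˡ {m} {n} v e = trans (∑-split m v) (trans (cong (∑ (v ∘ (_↑ˡ n)) ℕ.+_) (∑-zero e)) (ℕₚ.+-identityʳ _))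

∑-↑ʳ : ∀ {m n} (v : Vector ℕ (m + n)) → (∀ k → v (k ↑ˡ n) ≡ 0) → ∑ v ≡ ∑ (v ∘ (m ↑ʳ_))
∑-↑ʳ {m} v e = trans (∑-split m v) (cong (_+ ∑ (v ∘ (m ↑ʳ_))) (∑-zero e))

-- Cardinalities of the finite constructions.

card-≡1b : ∀ b → card (finite-≡ b 1b) ≡ toℕ b
card-≡1b zero       = refl
card-≡1b (suc zero) = refl

card-ΣFin : ∀ {m} {P : Fin m → Set} (fin : ∀ i → Finite (P i)) → card (finite-ΣFin fin) ≡ ∑ (card ∘ fin)
card-ΣFin {zero}  fin = refl
card-ΣFin {suc m} fin = cong (_ ℕ.+_) (card-ΣFin (fin ∘ suc))

Bounded : ℕ → (ℕ → Set) → Set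
Bounded n P = ∀ k → k ≤ n → Finite (P k)

-- `card` of a convolution is computed from the cards of the factors alone, so equal counts suffice
-- and no bijections between the underlying types have to be built.
card-conv-cong : ∀ {P P′ Q Q′} n
  {finP : Bounded n P} {finP′ : Bounded n P′} {finQ : Bounded n Q} {finQ′ : Bounded n Q′} →
  (∀ k k≤n → card (finP k k≤n) ≡ card (finP′ k k≤n)) →
  (∀ k k≤n → card (finQ k k≤n) ≡ card (finQ′ k k≤n)) →
  card (finite-conv n finP finQ) ≡ card (finite-conv n finP′ finQ′)
card-conv-cong zero    p q = cong₂ _*_ (p 0 z≤n) (q 0 z≤n)
card-conv-cong (suc n) p q = cong₂ _+_ (cong₂ _*_ (p 0 z≤n) (q (suc n) ℕₚ.≤-refl))
  (card-conv-cong n (λ k k≤n → p (suc k) (s≤s k≤n)) (λ k k≤n → q k (ℕₚ.m≤n⇒m≤1+n k≤n)))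

card-conv-zero : ∀ {P Q} n {finP : Bounded n P} {finQ : Bounded n Q} →
  (∀ k k≤n → card (finP k k≤n) ≡ 0) → card (finite-conv n finP finQ) ≡ 0
card-conv-zero zero    p = cong (_* _) (p 0 z≤n)
card-conv-zero (suc n) p = cong₂ _+_ (cong (_* _) (p 0 z≤n))
  (card-conv-zero n (λ k k≤n → p (suc k) (s≤s k≤n)))

-- Only the summand with first index 0 survives. For stars this says that the first tree of the
-- forest is a single leaf.
card-conv-head : ∀ {P Q} n {finP : Bounded n P} {finQ : Bounded n Q} →
  (∀ k 1+k≤n → card (finP (suc k) 1+k≤n) ≡ 0) →
  card (finite-conv n finP finQ) ≡ card (finP 0 z≤n) * card (finQ n ℕₚ.≤-refl)
card-conv-head zero    p = refl
card-conv-head (suc n) p = trans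
  (cong (_ ℕ.+_) (card-conv-zero n (λ k k≤n → p k (s≤s k≤n))))
  (ℕₚ.+-identityʳ _)

-- Forests below sinks and stars.

module _ {m} (A : Matrix m m) where

  #forest : ∀ N n → n ≤ N → Fin m → ℕ
  #forest N n n≤N i = card (finite-forest A N n n≤N i)

  -- The first factor of the convolution in `finite-forest`, named so that its count can be
  -- rewritten as a weighted sum.
  child : ∀ N n → n ≤ N → ∀ i → Finite (∃ λ j → A i j ≡ 1b × Forest A j n)
  child N n n≤N i = finite-ΣFin λ j → finite-× (finite-≡ (A i j) 1b) (finite-forest A N n n≤N j)

  card-child : ∀ N n n≤N i → card (child N n n≤N i) ≡ ∑ (λ j → toℕ (A i j) * #forest N n n≤N j)
  card-child N n n≤N i = trans
    (card-ΣFin λ j → finite-× (finite-≡ (A i j) 1b) (finite-forest A N n n≤N j))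
    (∑-cong λ j → cong (_* #forest N n n≤N j) (card-≡1b (A i j)))

  Sink : Fin m → Set
  Sink i = ∀ j → A i j ≡ 0b

  -- A nonempty forest has a first tree, and the color of its root needs an entry 1 in the zero row
  -- of `i`.
  #forest-sink : ∀ N n n<N i → Sink i → #forest N (suc n) n<N i ≡ 0
  #forest-sink (suc N) n (s≤s n≤N) i sink = card-conv-zero n λ k k≤n →
    let k≤N = ℕₚ.≤-trans k≤n n≤N in
    trans (card-child N k k≤N i) (∑-zero λ j → cong (λ b → toℕ b * #forest N k k≤N j) (sink j))

  module _ (i : Fin m) (children-sink : ∀ j → A i j ≡ 0b ⊎ Sink j) where

    -- Each further vertex is a new leaf child of the root, which multiplies the count by the number
    -- of allowed colors.
    #forest-star : ∀ N n n≤N → #forest N n n≤N i ≡ rowSum A i ^ n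
    #forest-star _       zero    _         = refl
    #forest-star (suc N) (suc n) (s≤s n≤N) = trans
      (card-conv-head n λ k k<n → trans (card-child N (suc k) (ℕₚ.≤-trans k<n n≤N) i)
        (∑-zero λ j → no-grandchildren k (ℕₚ.≤-trans k<n n≤N) j))
      -- The forest below a leaf is empty and counted once, so each weight in the sum over `j` is
      -- multiplied by 1.
      (cong₂ _*_ (trans (card-child N 0 z≤n i) (∑-cong λ j → ℕₚ.*-identityʳ (toℕ (A i j))))
                 (#forest-star N n _))
      where
      no-grandchildren : ∀ k k<N j → toℕ (A i j) * #forest N (suc k) k<N j ≡ 0
      no-grandchildren k k<N j with children-sink j
      ... | inj₁ e    = cong (λ b → toℕ b * #forest N (suc k) k<N j) e
      ... | inj₂ sink = trans (cong (toℕ (A i j) *_) (#forest-sink N k k<N j sink)) (ℕₚ.*-zeroʳ (toℕ (A i j)))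

    tRoot-star : ∀ n → tRoot A i (suc n) ≡ rowSum A i ^ n
    tRoot-star n = #forest-star n n ℕₚ.≤-refl

  t-∑ : ∀ n → t A n ≡ ∑ (λ i → tRoot A i n)
  t-∑ n = card-ΣFin λ i → finite-rooted A i n

-- Sets of colors closed under passing to children.

module _ {m p} (M : Matrix (m + p) (m + p)) (A : Matrix m m)
         (inside : ∀ i j → M (i ↑ˡ p) (j ↑ˡ p) ≡ A i j)
         (outside : ∀ i k → M (i ↑ˡ p) (m ↑ʳ k) ≡ 0b) where

  -- Columns beyond the first `m` contribute nothing to the choice of the first tree. The others
  -- agree by induction on the bound `N`, as does the remaining forest.
  #forest-closed : ∀ N n n≤N i → #forest M N n n≤N (i ↑ˡ p) ≡ #forest A N n n≤N i
  #forest-closed _       zero    _         i = refl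
  #forest-closed (suc N) (suc n) (s≤s n≤N) i = card-conv-cong n
    (λ k k≤n → same-children k (ℕₚ.≤-trans k≤n n≤N))
    (λ k k≤n → #forest-closed N k (ℕₚ.≤-trans k≤n n≤N) i)
    where
    same-children : ∀ k k≤N → card (child M N k k≤N (i ↑ˡ p)) ≡ card (child A N k k≤N i)
    same-children k k≤N = begin
      card (child M N k k≤N (i ↑ˡ p))
        ≡⟨ card-child M N k k≤N (i ↑ˡ p) ⟩
      ∑ (λ j → toℕ (M (i ↑ˡ p) j) * #forest M N k k≤N j)
        ≡⟨ ∑-↑ˡ {m} (λ j → toℕ (M (i ↑ˡ p) j) * #forest M N k k≤N j)
             (λ l → cong (λ b → toℕ b * #forest M N k k≤N (m ↑ʳ l)) (outside i l)) ⟩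
      ∑ (λ j → toℕ (M (i ↑ˡ p) (j ↑ˡ p)) * #forest M N k k≤N (j ↑ˡ p))
        ≡⟨ ∑-cong (λ j → cong₂ (λ b c → toℕ b * c) (inside i j) (#forest-closed N k k≤N j)) ⟩
      ∑ (λ j → toℕ (A i j) * #forest A N k k≤N j)
        ≡⟨ card-child A N k k≤N i ⟨
      card (child A N k k≤N i) ∎

  tRoot-closed : ∀ i n → tRoot M (i ↑ˡ p) n ≡ tRoot A i n
  tRoot-closed i zero    = refl
  tRoot-closed i (suc n) = #forest-closed n n ℕₚ.≤-refl i

-- Coefficients of the geometric series.

∑ᶻ-zero : ∀ {n} {v : Vector ℤ n} → (∀ i → v i ≡ 0ℤ) → ∑ᶻ v ≡ 0ℤ
∑ᶻ-zero {n} e = trans (sum-cong e) (∑ᶻ-replicate-zero n)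

∑ˢ-coeff : ∀ {m} (v : Vector Series m) (c : Vector ℕ m) n → (∀ i → v i n ≡ + c i) → ∑ˢ v n ≡ + ∑ c
∑ˢ-coeff {zero}  v c n e = refl
∑ˢ-coeff {suc m} v c n e = cong₂ ℤ._+_ (e zero) (∑ˢ-coeff (v ∘ suc) (c ∘ suc) n (e ∘ suc))

x*-suc : ∀ g n → (x *ˢ g) (suc n) ≡ g n
x*-suc g n = begin
  0ℤ ℤ.* g (suc n) ℤ.+ (1ℤ ℤ.* g n ℤ.+ s)
    ≡⟨ ℤₚ.+-identityˡ _ ⟩
  1ℤ ℤ.* g n ℤ.+ s
    ≡⟨ cong₂ ℤ._+_ (ℤₚ.*-identityˡ (g n)) (∑ᶻ-zero {n} (λ _ → refl)) ⟩
  g n ℤ.+ 0ℤ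
    ≡⟨ ℤₚ.+-identityʳ (g n) ⟩
  g n ∎
  where
  s : ℤ
  s = ∑ᶻ {n} (λ k → 0ℤ ℤ.* g (n ∸ suc (toℕ k)))

-- The denominator has no coefficients beyond degree 1, so the recurrence for the reciprocal
-- collapses to multiplication by `c`.
recip-geometric : ∀ c n → recip (1ˢ -ˢ x *ˢ const (+ c)) refl n ≡ + (c ^ n)
recip-geometric c zero    = refl
recip-geometric c (suc n) = begin
  0ℤ ℤ.- (f 1 ℤ.* g n ℤ.+ s)
    ≡⟨ cong₂ (λ a b → 0ℤ ℤ.- (a ℤ.* g n ℤ.+ b)) f₁ (∑ᶻ-zero {n} tail) ⟩
  0ℤ ℤ.- (ℤ.- (+ c) ℤ.* g n ℤ.+ 0ℤ)
    ≡⟨ ℤₚ.+-identityˡ _ ⟩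
  ℤ.- (ℤ.- (+ c) ℤ.* g n ℤ.+ 0ℤ)
    ≡⟨ cong ℤ.-_ (trans (ℤₚ.+-identityʳ _) (sym (ℤₚ.neg-distribˡ-* (+ c) (g n)))) ⟩
  ℤ.- (ℤ.- (+ c ℤ.* g n))
    ≡⟨ ℤₚ.neg-involutive _ ⟩
  + c ℤ.* g n
    ≡⟨ cong (+ c ℤ.*_) (recip-geometric c n) ⟩
  + c ℤ.* + (c ^ n)
    ≡⟨ ℤₚ.pos-* c (c ^ n) ⟨
  + (c ^ suc n) ∎
  where
  f g : Series
  f = 1ˢ -ˢ x *ˢ const (+ c)
  g = recip f refl
  s : ℤ
  s = ∑ᶻ {n} (λ k → f (suc (suc (toℕ k))) ℤ.* recipVec f n k)
  f₁ : f 1 ≡ ℤ.- (+ c)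
  f₁ = trans (ℤₚ.+-identityˡ _) (cong ℤ.-_ (x*-suc (const (+ c)) 0))
  tail : ∀ (k : Fin n) → f (suc (suc (toℕ k))) ℤ.* recipVec f n k ≡ 0ℤ
  tail k = cong (λ z → (0ℤ ℤ.- z) ℤ.* recipVec f n k) (x*-suc (const (+ c)) (suc (toℕ k)))

-- Entries of the block matrix.

↑-elim : ∀ m {n} (P : Fin (m + n) → Set) → (∀ i → P (i ↑ˡ n)) → (∀ i → P (m ↑ʳ i)) → ∀ i → P i
↑-elim zero    P l r i       = r i
↑-elim (suc m) P l r zero    = l zero
↑-elim (suc m) P l r (suc i) = ↑-elim m (P ∘ suc) (l ∘ suc) r i

module _ {m₁ m₂ m₃} (A₁ : Matrix m₁ m₁) (A₂ : Matrix m₁ m₂) (B : Matrix m₃ m₂) where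

  private
    A  = blockA A₁ A₂
    A′ = blockA′ A₁ A₂ B

    upper-rows : Matrix (m₁ + m₂) (m₁ + m₂ + m₃)
    upper-rows = A₁ ∥ A₂ ∥ 𝟎 m₁ m₃ ⫽ 𝟎 m₂ m₁ ∥ 𝟎 m₂ m₂ ∥ 𝟎 m₂ m₃

    lower-rows : Matrix m₃ (m₁ + m₂ + m₃)
    lower-rows = 𝟎 m₃ m₁ ∥ B ∥ 𝟎 m₃ m₃

  row-upper : ∀ i → A′ (i ↑ˡ m₃) ≡ upper-rows i
  row-upper = lookup-++ˡ upper-rows lower-rows

  row-lower : ∀ i → A′ ((m₁ + m₂) ↑ʳ i) ≡ lower-rows i
  row-lower = lookup-++ʳ upper-rows lower-rows

  upper-inside : ∀ i j → A′ (i ↑ˡ m₃) (j ↑ˡ m₃) ≡ A i j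
  -- After the rewrite both sides branch on the same `splitAt m₁ i`, so one case split reduces them
  -- together.
  upper-inside i j rewrite row-upper i with splitAt m₁ i
  ... | inj₁ k = lookup-++ˡ ((A₁ ∥ A₂) k) (𝟎 m₁ m₃ k) j
  ... | inj₂ k = lookup-++ˡ ((𝟎 m₂ m₁ ∥ 𝟎 m₂ m₂) k) (𝟎 m₂ m₃ k) j

  upper-outside : ∀ i k → A′ (i ↑ˡ m₃) ((m₁ + m₂) ↑ʳ k) ≡ 0b
  upper-outside i k rewrite row-upper i with splitAt m₁ i
  ... | inj₁ l = lookup-++ʳ ((A₁ ∥ A₂) l) (𝟎 m₁ m₃ l) k
  ... | inj₂ l = lookup-++ʳ ((𝟎 m₂ m₁ ∥ 𝟎 m₂ m₂) l) (𝟎 m₂ m₃ l) k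

  middle-sink : ∀ k → Sink A′ ((m₁ ↑ʳ k) ↑ˡ m₃)
  middle-sink k = ↑-elim (m₁ + m₂) _ zero-inside (upper-outside (m₁ ↑ʳ k))
    where
    A-zero : ∀ j → A (m₁ ↑ʳ k) j ≡ 0b
    A-zero j rewrite lookup-++ʳ (A₁ ∥ A₂) (𝟎 m₂ m₁ ∥ 𝟎 m₂ m₂) k with splitAt m₁ j
    ... | inj₁ _ = refl
    ... | inj₂ _ = refl
    zero-inside : ∀ j → A′ ((m₁ ↑ʳ k) ↑ˡ m₃) (j ↑ˡ m₃) ≡ 0b
    zero-inside j = trans (upper-inside (m₁ ↑ʳ k) j) (A-zero j)

  module _ (i : Fin m₃) where

    private
      row : Vector Bit (m₁ + m₂ + m₃)
      row = A′ ((m₁ + m₂) ↑ʳ i)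

    lower-inside : ∀ j → row (j ↑ˡ m₃) ≡ (𝟎 m₃ m₁ ∥ B) i j
    lower-inside j rewrite row-lower i = lookup-++ˡ ((𝟎 m₃ m₁ ∥ B) i) (𝟎 m₃ m₃ i) j

    lower-left : ∀ j → row ((j ↑ˡ m₂) ↑ˡ m₃) ≡ 0b
    lower-left j = trans (lower-inside (j ↑ˡ m₂)) (lookup-++ˡ (𝟎 m₃ m₁ i) (B i) j)

    lower-middle : ∀ j → row ((m₁ ↑ʳ j) ↑ˡ m₃) ≡ B i j
    lower-middle j = trans (lower-inside (m₁ ↑ʳ j)) (lookup-++ʳ (𝟎 m₃ m₁ i) (B i) j)

    lower-right : ∀ j → row ((m₁ + m₂) ↑ʳ j) ≡ 0b
    lower-right j rewrite row-lower i = lookup-++ʳ ((𝟎 m₃ m₁ ∥ B) i) (𝟎 m₃ m₃ i) j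

    -- This is the hypothesis of `tRoot-star`: only the columns of the middle block can hold a 1,
    -- and their colors are sinks.
    lower-children-sink : ∀ j → row j ≡ 0b ⊎ Sink A′ j
    lower-children-sink = ↑-elim (m₁ + m₂) _
      (↑-elim m₁ _ (inj₁ ∘ lower-left) (inj₂ ∘ middle-sink))
      (inj₁ ∘ lower-right)

    rowSum-lower : rowSum A′ ((m₁ + m₂) ↑ʳ i) ≡ rowSum B i
    rowSum-lower = begin
      ∑ (toℕ ∘ row)
        ≡⟨ ∑-↑ˡ {m₁ + m₂} _ (cong toℕ ∘ lower-right) ⟩
      ∑ (λ j → toℕ (row (j ↑ˡ m₃)))
        ≡⟨ ∑-↑ʳ {m₁} _ (cong toℕ ∘ lower-left) ⟩
      ∑ (λ j → toℕ (row ((m₁ ↑ʳ j) ↑ˡ m₃)))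
        ≡⟨ ∑-cong (cong toℕ ∘ lower-middle) ⟩
      rowSum B i ∎

    tRoot-lower : ∀ n → tRoot A′ ((m₁ + m₂) ↑ʳ i) (suc n) ≡ rowSum B i ^ n
    tRoot-lower n = trans (tRoot-star A′ ((m₁ + m₂) ↑ʳ i) lower-children-sink n) (cong (_^ n) rowSum-lower)

  -- Assembling the counts and the generating function.

  tRoot-upper : ∀ i n → tRoot A′ (i ↑ˡ m₃) n ≡ tRoot A i n
  tRoot-upper = tRoot-closed A′ A upper-inside upper-outside

  t-block : ∀ n → t A′ (suc n) ≡ t A (suc n) + ∑ (λ i → rowSum B i ^ n)
  t-block n = begin
    t A′ (suc n)
      ≡⟨ t-∑ A′ (suc n) ⟩
    ∑ (λ i → tRoot A′ i (suc n))
      ≡⟨ ∑-split (m₁ + m₂) _ ⟩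
    ∑ (λ i → tRoot A′ (i ↑ˡ m₃) (suc n)) + ∑ (λ i → tRoot A′ ((m₁ + m₂) ↑ʳ i) (suc n))
      ≡⟨ cong₂ _+_ (∑-cong λ i → tRoot-upper i (suc n)) (∑-cong λ i → tRoot-lower i n) ⟩
    ∑ (λ i → tRoot A i (suc n)) + ∑ (λ i → rowSum B i ^ n)
      ≡⟨ cong (λ s → s + ∑ (λ i → rowSum B i ^ n)) (t-∑ A (suc n)) ⟨
    t A (suc n) + ∑ (λ i → rowSum B i ^ n) ∎

  F-block : F A′ ≈ˢ F A +ˢ x *ˢ ∑ˢ (λ (i : Fin m₃) → recip (1ˢ -ˢ x *ˢ const (+ rowSum B i)) refl)
  F-block zero    = refl
  -- The factor `x` lowers the degree by one, matching the root that is not counted among the `n`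
  -- leaves of a star.
  F-block (suc n) = trans (cong +_ (t-block n))
    (cong (λ z → + t A (suc n) ℤ.+ z)
      (sym (trans (x*-suc (∑ˢ star) n) (∑ˢ-coeff star _ n λ i → recip-geometric (rowSum B i) n))))
    where
    star : Vector Series m₃
    star i = recip (1ˢ -ˢ x *ˢ const (+ rowSum B i)) refl

theorem31 : ∀ (m₁ m₂ m₃ : ℕ) .{{_ : NonZero m₁}} .{{_ : NonZero m₂}} .{{_ : NonZero m₃}}
    (A₁ : Matrix m₁ m₁) (A₂ : Matrix m₁ m₂) (B : Matrix m₃ m₂) →
    (F (blockA′ A₁ A₂ B) ≈ˢ F (blockA A₁ A₂) +ˢ x *ˢ ∑ˢ (λ (i : Fin m₃) → recip (1ˢ -ˢ x *ˢ const (+ rowSum B i)) refl))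
    × (∀ (i : Fin (m₁ + m₂)) (n : ℕ) → 1 ≤ n → tRoot (blockA′ A₁ A₂ B) (i ↑ˡ m₃) n ≡ tRoot (blockA A₁ A₂) i n)
    × (∀ (i : Fin m₃) (n : ℕ) → 1 ≤ n → tRoot (blockA′ A₁ A₂ B) ((m₁ + m₂) ↑ʳ i) n ≡ rowSum B i ^ (n ∸ 1))
theorem31 m₁ m₂ m₃ A₁ A₂ B =
    F-block A₁ A₂ B
  , (λ i n _ → tRoot-upper A₁ A₂ B i n)
  -- The bound `1 ≤ n` matters: at 0 there are no trees, while truncated subtraction would make the
  -- power equal to 1.
  , (λ { i (suc n) _ → tRoot-lower A₁ A₂ B i n })
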